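{- For all integers $\Delta,g\geq 3$ there exists a $\Delta$-regular graph $G$ with girth at least $g$ that has frozen $(\Delta+1)$-colourings (i.e. at least one proper $(\Delta+1)$-colouring of $G$ is frozen).
   Context: All graphs are finite, simple and labeled. A (proper) $k$-colouring of $G$ is a function $\alpha:V(G)\to[k]$ with $\alpha(x)\neq\alpha(y)$ for every edge $xy$. For $G$ of maximum degree $\Delta$, a proper $(\Delta+1)$-colouring of $G$ is frozen if for every vertex $v$ all $\Delta+1$ colours appear in the closed neighbourhood $N[v]=N(v)\cup\{v\}$. The girth is the length of a shortest cycle. -}

module Defs where

open import Level using (0ℓ)
open import Data.Nat.Base using (ℕ; suc; _≤_)
open import Data.Fin.Base using (Fin; zero; suc; inject₁; fromℕ)
open import Data.Fin.Subset using (Subset; _∈_; _∪_; ⁅_⁆; ∣_∣)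
open import Data.Vec.Base using (tabulate)
open import Data.Product.Base using (∃-syntax; _×_)
open import Function.Definitions using (Injective)
open import Relation.Nullary.Decidable.Core using (does)
open import Relation.Binary.Core using (Rel)
open import Relation.Binary.Definitions using (Decidable; Symmetric; Irreflexive)
open import Relation.Binary.PropositionalEquality.Core using (_≡_; _≢_)

record Graph : Set₁ where
  field
    order  : ℕ
    Adj    : Rel (Fin order) 0ℓ
    adj?   : Decidable Adj
    sym    : Symmetric Adj
    irrefl : Irreflexive _≡_ Adj

  Vertex : Set
  Vertex = Fin order

  N : Vertex → Subset order
  N v = tabulate λ u → does (adj? v u)

  N[_] : Vertex → Subset order
  N[ v ] = N v ∪ ⁅ v ⁆

  degree : Vertex → ℕ
  degree v = ∣ N v ∣

open Graph public using (Vertex)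

Regular : ℕ → Graph → Set
Regular d G = ∀ v → degree v ≡ d
  where open Graph G

-- A cycle of length suc m, listed as v₀, …, vₘ with vₘ adjacent to v₀.
record IsCycle (G : Graph) {m : ℕ} (v : Fin (suc m) → Vertex G) : Set where
  open Graph G using (Adj)
  field
    length≥3  : 3 ≤ suc m
    injective : Injective _≡_ _≡_ v
    step      : ∀ (i : Fin m) → Adj (v (inject₁ i)) (v (suc i))
    close     : Adj (v (fromℕ m)) (v zero)

data HasCycle (G : Graph) : ℕ → Set where
  cycle : ∀ {m} (v : Fin (suc m) → Vertex G) → IsCycle G v → HasCycle G (suc m)

-- A forest has no girth in this sense.
IsGirth : Graph → ℕ → Set
IsGirth G γ = HasCycle G γ × (∀ ℓ → HasCycle G ℓ → γ ≤ ℓ)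

-- In particular G contains a cycle, and so is nonempty.
GirthAtLeast : ℕ → Graph → Set
GirthAtLeast g G = ∃[ γ ] IsGirth G γ × g ≤ γ

Colouring : Graph → ℕ → Set
Colouring G k = Vertex G → Fin k

Proper : (G : Graph) {k : ℕ} → Colouring G k → Set
Proper G α = ∀ {x y} → Adj x y → α x ≢ α y
  where open Graph G

Frozen : (G : Graph) {k : ℕ} → Colouring G k → Set
Frozen G {k} α = ∀ v (c : Fin k) → ∃[ u ] u ∈ N[ v ] × α u ≡ c
  where open Graph G

{-# OPTIONS --safe #-}

-- A Δ-regular graph has a frozen (Δ+1)-colouring exactly when it covers K_{Δ+1}, and a lift of
-- a cover is again a cover.  Starting from K_{Δ+1}, replace a graph G repeatedly by its lift on
-- V(G) × 𝔽₂^{E(G)} in which traversing the edge e flips the coordinate e.  A closed walk of the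
-- lift projects to a closed walk of G that uses every edge an even number of times, so it is not
-- a shortest cycle of G: the girth strictly increases.
module Submission where

open import Data.Nat using (ℕ; zero; suc; _+_; _*_; _^_; _≤_; _<_; z≤n; s≤s; s<s)
open import Data.Nat.GeneralisedArithmetic using (fold)
open import Data.Nat.Induction using (<-rec)
import Data.Nat.Properties as ℕ
open import Data.Fin using (Fin; zero; suc; toℕ; fromℕ; inject₁; opposite; punchIn; punchOut; combine; quotient; remainder; finToFun; funToFin)
open import Data.Fin.Induction using (<-weakInduction)
open import Data.Fin.Properties using (_≟_; all?; any?; pigeonhole; toℕ-injective; toℕ-inject₁; toℕ-fromℕ; toℕ<n; opposite-involutive; punchIn-injective; punchInᵢ≢i; punchIn-punchOut; remQuot-combine; combine-remQuot; combine-injective; finToFun-funToFin; funToFin-finToFin)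
open import Data.Fin.Relation.Unary.Top using (view; ‵fromℕ; ‵inject₁; view-fromℕ; view-inject₁)
open import Data.Fin.Subset using (Subset; _∈_; _-_; ∣_∣; inside; outside)
open import Data.Fin.Subset.Properties using (Empty-unique; ∣⊥∣≡0; p─⊥≡p; x∈p∧x≢y⇒x∈p-y; p─q⊆p; x∈p∪q⁺; x∈⁅x⁆)
open import Data.Product using (_×_; Σ-syntax; ∃-syntax; _,_; proj₁; proj₂)
open import Data.Sum using (inj₁; inj₂)
open import Data.Vec using (_∷_; here; there; tabulate)
open import Data.Vec.Properties using ([]=⇒lookup; lookup⇒[]=; lookup∘tabulate)
open import Data.Vec.Functional using (updateAt)
open import Data.Vec.Functional.Properties using (updateAt-updates; updateAt-minimal)
open import Function using (_∘_)
open import Function.Definitions using (Injective)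
open import Relation.Binary.Definitions using (Decidable; tri<; tri≈; tri>)
open import Relation.Binary.PropositionalEquality using (_≡_; _≢_; _≗_; refl; sym; trans; cong; cong₂; subst; subst₂; module ≡-Reasoning)
open import Relation.Nullary using (Dec; yes; no; ¬_; does; contradiction)
open import Relation.Nullary.Decidable using (map′; ¬?; _×-dec_; _→-dec_; dec-true)
import Relation.Unary as Unary
open import Defs

-- Cardinality of finite subsets

x∉p-x : ∀ {n} {p : Subset n} {x} → ¬ x ∈ p - x
x∉p-x {p = b ∷ p}       {suc x} (there x∈p-x) = x∉p-x {p = p} x∈p-x
x∉p-x {p = inside ∷ p}  {zero}  ()
x∉p-x {p = outside ∷ p} {zero}  ()

∣p∣≡1+∣p-x∣ : ∀ {n} {p : Subset n} {x} → x ∈ p → ∣ p ∣ ≡ suc ∣ p - x ∣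
∣p∣≡1+∣p-x∣ {p = _ ∷ p} here = cong (suc ∘ ∣_∣) (sym (p─⊥≡p p))
∣p∣≡1+∣p-x∣ {p = inside ∷ _}  (there x∈p) = cong suc (∣p∣≡1+∣p-x∣ x∈p)
∣p∣≡1+∣p-x∣ {p = outside ∷ _} (there x∈p) = ∣p∣≡1+∣p-x∣ x∈p

-- Induction on `d`, deleting `f zero` from `p` each time; `regular` counts neighbours with it.
∣image∣ : ∀ {n} d (f : Fin d → Fin n) (p : Subset n) → Injective _≡_ _≡_ f →
          (∀ i → f i ∈ p) → (∀ {x} → x ∈ p → ∃[ i ] f i ≡ x) → ∣ p ∣ ≡ d
∣image∣ {n} zero f p inj into onto =
  trans (cong ∣_∣ (Empty-unique λ (x , x∈p) → contradiction (proj₁ (onto x∈p)) λ ())) (∣⊥∣≡0 n)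
∣image∣ (suc d) f p inj into onto =
  trans (∣p∣≡1+∣p-x∣ (into zero)) (cong suc (∣image∣ d (f ∘ suc) (p - f zero) inj′ into′ onto′))
  where
  inj′ : Injective _≡_ _≡_ (f ∘ suc)
  inj′ eq with refl ← inj eq = refl

  into′ : ∀ i → f (suc i) ∈ p - f zero
  into′ i = x∈p∧x≢y⇒x∈p-y (into (suc i)) λ eq → contradiction (inj eq) λ ()

  onto′ : ∀ {x} → x ∈ p - f zero → ∃[ i ] f (suc i) ≡ x
  onto′ x∈ with onto (p─q⊆p p _ x∈)
  ... | zero  , refl = contradiction x∈ (x∉p-x {p = p})
  ... | suc i , eq   = i , eq

∈-tabulate⁺ : ∀ {n} {P : Fin n → Set} (P? : Unary.Decidable P) {x} →
              P x → x ∈ tabulate (does ∘ P?)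
∈-tabulate⁺ P? {x} px =
  lookup⇒[]= x _ (trans (lookup∘tabulate _ x) (dec-true (P? x) px))

∈-tabulate⁻ : ∀ {n} {P : Fin n → Set} (P? : Unary.Decidable P) {x} →
              x ∈ tabulate (does ∘ P?) → P x
∈-tabulate⁻ P? {x} x∈ with P? x | trans (sym (lookup∘tabulate (does ∘ P?) x)) ([]=⇒lookup x∈)
... | yes px | _ = px

-- Covers of complete graphs

-- A finite cover of the complete graph on k vertices: nbr v c is the unique vertex of colour c
-- in the closed neighbourhood of v.
record Cover (k : ℕ) : Set where
  field
    order    : ℕ
    base     : Fin order
    col      : Fin order → Fin k
    nbr      : Fin order → Fin k → Fin order
    col-nbr  : ∀ v c → col (nbr v c) ≡ c
    nbr-self : ∀ v → nbr v (col v) ≡ v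
    nbr-back : ∀ v c → nbr (nbr v c) (col v) ≡ v

  -- `nbr u (col u)` is `u` itself, so the colour condition is what excludes loops.
  Adj : Fin order → Fin order → Set
  Adj u v = col u ≢ col v × nbr u (col v) ≡ v

  Adj? : Decidable Adj
  Adj? u v = ¬? (col u ≟ col v) ×-dec (nbr u (col v) ≟ v)

  Adj-sym : ∀ {u v} → Adj u v → Adj v u
  Adj-sym {u} {v} (u≁v , eq) =
    u≁v ∘ sym , trans (cong (λ x → nbr x (col u)) (sym eq)) (nbr-back u (col v))

  Adj-nbr : ∀ v {c} → col v ≢ c → Adj v (nbr v c)
  Adj-nbr v {c} v≁c rewrite col-nbr v c = v≁c , refl

  graph : Graph
  graph = record
    { order  = order
    ; Adj    = Adj
    ; adj?   = Adj?
    ; sym    = Adj-sym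
    ; irrefl = λ { refl (v≁v , _) → v≁v refl }
    }

  col-proper : Proper graph col
  col-proper = proj₁

  col-frozen : Frozen graph col
  col-frozen v c with col v ≟ c
  ... | yes refl = v , x∈p∪q⁺ (inj₂ (x∈⁅x⁆ v)) , refl
  ... | no v≁c   = nbr v c , x∈p∪q⁺ (inj₁ (∈-tabulate⁺ (Adj? v) (Adj-nbr v v≁c))) , col-nbr v c

  -- The walk does not backtrack, since a neighbour is determined by its colour.
  record ReducedWalk (w : ℕ → Fin order) : Set where
    field
      step : ∀ i → Adj (w i) (w (suc i))
      turn : ∀ i → col (w i) ≢ col (w (2 + i))

  -- Walks are infinite, so nothing is asked of the turn at the closing vertex, and every closed
  -- segment of a reduced walk qualifies after a shift.
  ClosedWalkBound : ℕ → Set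
  ClosedWalkBound k = ∀ {w} → ReducedWalk w → ∀ ℓ → w 0 ≡ w (suc ℓ) → k ≤ suc ℓ

open Cover using (graph; ReducedWalk; ClosedWalkBound)
open ReducedWalk

-- Neighbours of `v` correspond to the colours other than `col v`, which `punchIn (col v)`
-- enumerates.
regular : ∀ {d} (C : Cover (suc d)) → Regular d (graph C)
regular {d} C v = ∣image∣ d f _ f-injective into onto
  where
  open Cover C hiding (graph; ReducedWalk; ClosedWalkBound)
  f : Fin d → Fin order
  f = nbr v ∘ punchIn (col v)

  f-injective : Injective _≡_ _≡_ f
  f-injective {i} {j} eq =
    punchIn-injective (col v) i j (trans (sym (col-nbr v _)) (trans (cong col eq) (col-nbr v _)))

  into : ∀ i → f i ∈ Graph.N (graph C) v
  into i = ∈-tabulate⁺ (Adj? v) (Adj-nbr v (punchInᵢ≢i (col v) i ∘ sym))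

  onto : ∀ {u} → u ∈ Graph.N (graph C) v → ∃[ i ] f i ≡ u
  onto u∈ with v≁u , eq ← ∈-tabulate⁻ (Adj? v) u∈ =
    punchOut v≁u , trans (cong (nbr v) (punchIn-punchOut v≁u)) eq

shift : ∀ {k} (C : Cover k) {w} → ReducedWalk C w → ∀ i → ReducedWalk C (λ j → w (j + i))
shift C W i = record { step = λ j → step W (j + i) ; turn = λ j → turn W (j + i) }

complete : ∀ k → Cover (suc k)
complete k = record
  { order    = suc k
  ; base     = zero
  ; col      = λ v → v
  ; nbr      = λ _ c → c
  ; col-nbr  = λ _ _ → refl
  ; nbr-self = λ _ → refl
  ; nbr-back = λ _ _ → refl
  }

-- Bit vectors

funToFin-cong : ∀ {m n} {f g : Fin m → Fin n} → f ≗ g → funToFin f ≡ funToFin g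
funToFin-cong {zero}  f≗g = refl
funToFin-cong {suc m} f≗g = cong₂ combine (f≗g zero) (funToFin-cong (f≗g ∘ suc))

module _ {m : ℕ} where

  -- Vectors over 𝔽₂ are coded as numbers because the vertices of a `Graph` form a `Fin`; on
  -- `Fin 2`, `opposite` is negation.
  bit : Fin m → Fin (2 ^ m) → Fin 2
  bit e s = finToFun s e

  toggle : Fin m → Fin (2 ^ m) → Fin (2 ^ m)
  toggle e s = funToFin (updateAt (finToFun s) e opposite)

  bit-toggle : ∀ e s → bit e (toggle e s) ≡ opposite (bit e s)
  bit-toggle e s = trans (finToFun-funToFin _ e) (updateAt-updates e (finToFun s))

  bit-toggle-≢ : ∀ {e e′} → e ≢ e′ → ∀ s → bit e (toggle e′ s) ≡ bit e s
  bit-toggle-≢ {e} {e′} e≢e′ s =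
    trans (finToFun-funToFin _ e) (updateAt-minimal e e′ (finToFun s) e≢e′)

  toggle-involutive : ∀ e s → toggle e (toggle e s) ≡ s
  toggle-involutive e s = trans (funToFin-cong pointwise) (funToFin-finToFin {m} {2} s)
    where
    pointwise : updateAt (finToFun (toggle e s)) e opposite ≗ finToFun s
    pointwise i with i ≟ e
    ... | yes refl = trans (updateAt-updates i (finToFun (toggle e s)))
                           (trans (cong opposite (bit-toggle i s)) (opposite-involutive _))
    ... | no i≢e   = trans (updateAt-minimal i e (finToFun (toggle e s)) i≢e) (bit-toggle-≢ i≢e s)

-- The lift by edge parities

module Lift {k : ℕ} (C : Cover k) where
  open Cover C hiding (graph; ReducedWalk; ClosedWalkBound)

  -- One bit per ordered pair of vertices, so that `combine` indexes the edges without an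
  -- enumeration of them.
  State : Set
  State = Fin (2 ^ (order * order))

  -- Flipping the bits of both orientations makes traversing an edge back and forth cancel, and
  -- makes the loop v → v act trivially.
  flip : Fin order → Fin order → State → State
  flip u v s = toggle (combine u v) (toggle (combine v u) s)

  flip-self : ∀ v s → flip v v s ≡ s
  flip-self v = toggle-involutive (combine v v)

  flip-back : ∀ u v s → flip v u (flip u v s) ≡ s
  flip-back u v s =
    trans (cong (toggle (combine v u)) (toggle-involutive (combine u v) _))
          (toggle-involutive (combine v u) s)

  V : Set
  V = Fin (order * 2 ^ (order * order))

  vertex : V → Fin order
  vertex = quotient (2 ^ (order * order))

  state : V → State
  state = remainder {order} (2 ^ (order * order))

  vertex-combine : ∀ v s → vertex (combine v s) ≡ v
  vertex-combine v s = cong proj₁ (remQuot-combine {order} v s)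

  state-combine : ∀ v s → state (combine v s) ≡ s
  state-combine v s = cong proj₂ (remQuot-combine {order} v s)

  -- Colours are pulled back along `vertex`; the laws survive because `flip` is trivial on loops and
  -- undone by the reverse traversal.
  lift : Cover k
  lift = record
    { order    = order * 2 ^ (order * order)
    ; base     = combine base (funToFin {order * order} λ _ → zero)
    ; col      = λ x → col (vertex x)
    ; nbr      = λ x c → nbr′ (vertex x) (state x) c
    ; col-nbr  = λ x c → trans (cong col (vertex-combine _ _)) (col-nbr (vertex x) c)
    ; nbr-self = λ x → trans
        (cong₂ combine (nbr-self (vertex x))
          (trans (cong (λ v → flip (vertex x) v (state x)) (nbr-self (vertex x)))
                 (flip-self (vertex x) (state x))))
        (combine-remQuot {order} _ x)
    ; nbr-back = λ x c → let u = nbr (vertex x) c in trans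
        (cong₂ (λ v s → nbr′ v s (col (vertex x))) (vertex-combine _ _) (state-combine _ _))
        (trans (cong₂ combine (nbr-back (vertex x) c)
                 (trans (cong (λ v → flip u v (flip (vertex x) u (state x))) (nbr-back (vertex x) c))
                        (flip-back (vertex x) _ (state x))))
               (combine-remQuot {order} _ x))
    }
    where
    nbr′ : Fin order → State → Fin k → V
    nbr′ v s c = combine (nbr v c) (flip v (nbr v c) s)

  module _ {w : ℕ → V} (W : ReducedWalk lift w) where

    project : ReducedWalk C (vertex ∘ w)
    project = record
      { step = λ i → proj₁ (step W i)
                   , trans (sym (vertex-combine _ _)) (cong vertex (proj₂ (step W i)))
      ; turn = turn W
      }

    state-step : ∀ i → state (w (suc i)) ≡ flip (vertex (w i)) (vertex (w (suc i))) (state (w i))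
    state-step i =
      trans (cong state (sym (proj₂ (step W i))))
      (trans (state-combine _ _)
             (cong (λ v → flip (vertex (w i)) v (state (w i))) (proj₂ (step project i))))

    -- If the projection is as short as possible, it meets its first edge only once.
    closed-≢ : ∀ {ℓ} → ClosedWalkBound C (suc ℓ) → w 0 ≢ w (suc ℓ)
    closed-≢ {ℓ} bound w₀≡wₗ =
      opposite-≢ (trans (sym (b-later ℓ ℕ.≤-refl)) (cong (bit e ∘ state) (sym w₀≡wₗ)))
      where
      p : ℕ → Fin order
      p = vertex ∘ w

      e : Fin (order * order)
      e = combine (p 0) (p 1)

      opposite-≢ : ∀ {b : Fin 2} → opposite b ≢ b
      opposite-≢ {zero}     ()
      opposite-≢ {suc zero} ()

      e-≢ : ∀ {u v} → ¬ (p 0 ≡ u × p 1 ≡ v) → e ≢ combine u v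
      e-≢ ne eq = ne (combine-injective _ _ _ _ eq)

      p₀≢p₁ : p 0 ≢ p 1
      p₀≢p₁ eq = proj₁ (step project 0) (cong col eq)

      -- An earlier return to `p 0` would be a closed walk shorter than the bound.
      p₀-once : ∀ i → i < ℓ → p 0 ≢ p (suc i)
      p₀-once i i<ℓ eq = ℕ.<⇒≱ (s<s i<ℓ) (bound project i eq)

      -- Crossing the first edge in reverse straight away is a backtrack; doing so later needs a
      -- return to `p 1`, a closed walk that is again too short.
      p₁-once : ∀ i → i < ℓ → ¬ (p 0 ≡ p (2 + i) × p 1 ≡ p (1 + i))
      p₁-once zero    _   (eq , _) = turn W 0 (cong col eq)
      p₁-once (suc i) i<ℓ (_ , eq) = ℕ.<⇒≱ (s<s (ℕ.<-trans (ℕ.n<1+n i) i<ℓ))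
        (bound (shift C project 1) i (trans eq (cong (p ∘ suc) (ℕ.+-comm 1 i))))

      -- The outer toggle of step 0 flips bit `e`; in every later step both orientations of the edge
      -- have an index other than `e`.
      b-later : ∀ i → i ≤ ℓ → bit e (state (w (suc i))) ≡ opposite (bit e (state (w 0)))
      b-later zero _ = begin
        bit e (state (w 1))                                       ≡⟨ cong (bit e) (state-step 0) ⟩
        bit e (toggle e (toggle (combine (p 1) (p 0)) (state (w 0)))) ≡⟨ bit-toggle e _ ⟩
        opposite (bit e (toggle (combine (p 1) (p 0)) (state (w 0)))) ≡⟨ cong opposite (bit-toggle-≢ (e-≢ (p₀≢p₁ ∘ proj₁)) _) ⟩
        opposite (bit e (state (w 0)))                            ∎
        where open ≡-Reasoning
      b-later (suc i) i<ℓ =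
        trans (cong (bit e) (state-step (suc i)))
        (trans (bit-toggle-≢ (e-≢ (p₀-once i i<ℓ ∘ proj₁)) _)
        (trans (bit-toggle-≢ (e-≢ (p₁-once i i<ℓ)) _)
               (b-later i (ℕ.<⇒≤ i<ℓ))))

  -- The projection gives `g ≤ suc ℓ`, and `closed-≢` rules out equality.
  lift-bound : ∀ {g} → ClosedWalkBound C g → ClosedWalkBound lift (suc g)
  lift-bound bound W ℓ eq with ℕ.m≤n⇒m<n∨m≡n (bound (project W) ℓ (cong vertex eq))
  ... | inj₁ g<1+ℓ = g<1+ℓ
  ... | inj₂ refl  = contradiction eq (closed-≢ W bound)

tower : ∀ k → ℕ → Cover (suc k)
tower k zero    = complete k
tower k (suc g) = Lift.lift (tower k g)

-- The bound 0 is trivial at the bottom and each lift adds one, so `g` lifts are enough.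
tower-bound : ∀ k g → ClosedWalkBound (tower k g) g
tower-bound k zero    _ _ _ = z≤n
tower-bound k (suc g)       = Lift.lift-bound (tower k g) (tower-bound k g)

-- Cycles as closed reduced walks

-- The cyclic successor, with which a cycle is wound around forever as an infinite walk.
next : ∀ {m} → Fin (suc m) → Fin (suc m)
next i with view i
... | ‵fromℕ     = zero
... | ‵inject₁ j = suc j

next-fromℕ : ∀ m → next (fromℕ m) ≡ zero
next-fromℕ m rewrite view-fromℕ m = refl

next-inject₁ : ∀ {m} (i : Fin m) → next (inject₁ i) ≡ suc i
next-inject₁ i rewrite view-inject₁ i = refl

fold-next : ∀ {m} (i : Fin (suc m)) → fold zero next (toℕ i) ≡ i
fold-next = <-weakInduction (λ i → fold zero next (toℕ i) ≡ i) refl λ i ih →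
  trans (cong next (trans (cong (fold zero next) (sym (toℕ-inject₁ i))) ih)) (next-inject₁ i)

-- This would fail on two positions; it is where `length≥3` enters.
next²-≢ : ∀ {m} (i : Fin (3 + m)) → i ≢ next (next i)
next²-≢ i with view i
... | ‵fromℕ = λ ()
... | ‵inject₁ j with view j
...   | ‵fromℕ     = λ ()
...   | ‵inject₁ j′ = λ eq →
  ℕ.m≢1+n+m (toℕ j′) (trans (sym (trans (toℕ-inject₁ (inject₁ j′)) (toℕ-inject₁ j′))) (cong toℕ eq))

cycle-bound : ∀ {k g ℓ} (C : Cover k) → ClosedWalkBound C g → HasCycle (graph C) ℓ → g ≤ ℓ
cycle-bound C bound (cycle {m} v isCycle) = bound W m (cong v (sym closed))
  where
  open Cover C hiding (graph; ReducedWalk; ClosedWalkBound)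
  open IsCycle isCycle renaming (step to v-step)
  w : ℕ → Fin order
  w i = v (fold zero next i)

  v-next : ∀ i → Adj (v i) (v (next i))
  v-next i with view i
  ... | ‵fromℕ     = close
  ... | ‵inject₁ j = v-step j

  v-turn : 3 ≤ suc m → ∀ i → v i ≢ v (next (next i))
  v-turn (s≤s (s≤s (s≤s _))) i = next²-≢ i ∘ injective

  W : ReducedWalk C w
  W = record
    { step = λ i → v-next (fold zero next i)
    -- If vertices two apart had the same colour, both would be the neighbour of that colour of the
    -- vertex between them, hence equal.
    ; turn = λ i eq → v-turn length≥3 (fold zero next i)
        (trans (sym (proj₂ (Adj-sym (v-next _))))
        (trans (cong (nbr _) eq) (proj₂ (v-next _))))
    }

  closed : fold zero next (suc m) ≡ zero
  closed = trans (cong next (trans (cong (fold zero next) (sym (toℕ-fromℕ m))) (fold-next (fromℕ m))))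
                 (next-fromℕ m)

module _ {k : ℕ} (C : Cover k) where
  open Cover C hiding (graph; ReducedWalk; ClosedWalkBound)

  -- Lengths one and two are impossible, since vertices one or two steps apart differ in colour.
  injective-cycle : ∀ {w} → ReducedWalk C w → ∀ {ℓ} → w 0 ≡ w (suc ℓ) →
                    (∀ {i j} → i < j → j ≤ ℓ → w i ≢ w j) → HasCycle (graph C) (suc ℓ)
  injective-cycle {w} W {ℓ} w₀≡wₗ distinct = cycle (w ∘ toℕ) record
    { length≥3  = ℓ≥2 ℓ w₀≡wₗ
    ; injective = λ {i} {j} eq → toℕ-injective (inj i j eq)
    ; step      = λ i → subst (λ j → Adj (w j) (w (suc (toℕ i)))) (sym (toℕ-inject₁ i)) (step W (toℕ i))
    ; close     = subst₂ Adj (cong w (sym (toℕ-fromℕ ℓ))) (sym w₀≡wₗ) (step W ℓ)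
    }
    where
    ℓ≥2 : ∀ ℓ → w 0 ≡ w (suc ℓ) → 3 ≤ suc ℓ
    ℓ≥2 zero          eq = contradiction (cong col eq) (proj₁ (step W 0))
    ℓ≥2 (suc zero)    eq = contradiction (cong col eq) (turn W 0)
    ℓ≥2 (suc (suc ℓ)) eq = s≤s (s≤s (s≤s z≤n))

    inj : ∀ (i j : Fin (suc ℓ)) → w (toℕ i) ≡ w (toℕ j) → toℕ i ≡ toℕ j
    inj i j eq with ℕ.<-cmp (toℕ i) (toℕ j)
    ... | tri< i<j _ _ = contradiction eq (distinct i<j (ℕ.≤-pred (toℕ<n j)))
    ... | tri≈ _ i≡j _ = i≡j
    ... | tri> _ _ j<i = contradiction (sym eq) (distinct j<i (ℕ.≤-pred (toℕ<n i)))

  -- Strong induction on `ℓ`: the segment between two visits to one vertex is a shorter closed walk,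
  -- and without a repeat the walk is a cycle.
  closed-walk⇒cycle : ∀ ℓ {w} → ReducedWalk C w → w 0 ≡ w (suc ℓ) → ∃[ m ] HasCycle (graph C) m
  closed-walk⇒cycle = <-rec _ shorten
    where
    shorten : ∀ ℓ → (∀ {ℓ′} → ℓ′ < ℓ → ∀ {w} → ReducedWalk C w → w 0 ≡ w (suc ℓ′) → ∃[ m ] HasCycle (graph C) m) →
              ∀ {w} → ReducedWalk C w → w 0 ≡ w (suc ℓ) → ∃[ m ] HasCycle (graph C) m
    shorten ℓ rec {w} W w₀≡wₗ
      with ℕ.anyUpTo? (λ j → ℕ.anyUpTo? (λ i → w i ≟ w j) j) (suc ℓ)
    ... | no ¬repeat = suc ℓ , injective-cycle W w₀≡wₗ
            λ {i} {j} i<j j≤ℓ eq → ¬repeat (j , s≤s j≤ℓ , i , i<j , eq)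
    -- Here `j` is `suc i + o`: the segment from `i` has length `suc o`, and `j ≤ ℓ` gives `o < ℓ`.
    ... | yes (j , j<1+ℓ , i , i<j , eq) with o , refl ← ℕ.m≤n⇒∃[o]m+o≡n i<j =
      rec (ℕ.≤-trans (s≤s (ℕ.m≤n+m o i)) (ℕ.≤-pred j<1+ℓ)) (shift C W i)
          (trans eq (cong (w ∘ suc) (ℕ.+-comm i o)))

module _ {d : ℕ} (C : Cover (3 + d)) where
  open Cover C hiding (graph; ReducedWalk; ClosedWalkBound)

  -- An infinite reduced walk must repeat a vertex among its first `suc order` ones.
  has-cycle : ∃[ m ] HasCycle (graph C) m
  has-cycle =
    let i , j , i<j , eq = pigeonhole (ℕ.n<1+n order) (w ∘ toℕ)
        o , i+o≡j        = ℕ.m≤n⇒∃[o]m+o≡n i<j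
    in closed-walk⇒cycle C o (shift C W (toℕ i))
      (trans eq (cong w (trans (sym i+o≡j) (cong suc (ℕ.+-comm (toℕ i) o)))))
    where
    -- The colours 0, 1, 2 repeated periodically: any three in a row are distinct, so the walk that
    -- follows them is reduced.
    c : ℕ → Fin (3 + d)
    c 0 = zero
    c 1 = suc zero
    c 2 = suc (suc zero)
    c (suc (suc (suc i))) = c i

    w : ℕ → Fin order
    w zero    = nbr base (c 0)
    w (suc i) = nbr (w i) (c (suc i))

    col-w : ∀ i → col (w i) ≡ c i
    col-w zero    = col-nbr _ _
    col-w (suc i) = col-nbr _ _

    c-step : ∀ i → c i ≢ c (1 + i)
    c-step 0 ()
    c-step 1 ()
    c-step 2 ()
    c-step (suc (suc (suc i))) = c-step i

    c-turn : ∀ i → c i ≢ c (2 + i)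
    c-turn 0 ()
    c-turn 1 ()
    c-turn 2 ()
    c-turn (suc (suc (suc i))) = c-turn i

    W : ReducedWalk C w
    W = record
      { step = λ i → Adj-nbr (w i) (c-step i ∘ trans (sym (col-w i)))
      ; turn = λ i eq → c-turn i (trans (sym (col-w i)) (trans eq (col-w (2 + i))))
      }

-- Existence of the girth

module _ (G : Graph) where
  open Graph G using (order; Adj; adj?)

  isCycle? : ∀ {m} (v : Fin (suc m) → Vertex G) → Dec (IsCycle G v)
  isCycle? {m} v = map′
    (λ (l , i , s , c) → record { length≥3 = l ; injective = λ {x} {y} → i x y ; step = s ; close = c })
    (λ C → let open IsCycle C renaming (step to v-step) in length≥3 , (λ _ _ → injective) , v-step , close)
    (3 ℕ.≤? suc m ×-dec
     all? (λ i → all? λ j → (v i ≟ v j) →-dec (i ≟ j)) ×-dec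
     all? (λ i → adj? (v (inject₁ i)) (v (suc i))) ×-dec
     adj? (v (fromℕ m)) (v zero))

  isCycle-cong : ∀ {m} {v v′ : Fin (suc m) → Vertex G} → v ≗ v′ → IsCycle G v → IsCycle G v′
  isCycle-cong {m} eq C = record
    { length≥3  = length≥3
    ; injective = λ {i} {j} e → injective (trans (eq i) (trans e (sym (eq j))))
    ; step      = λ i → subst₂ Adj (eq (inject₁ i)) (eq (suc i)) (v-step i)
    ; close     = subst₂ Adj (eq (fromℕ m)) (eq zero) close
    }
    where open IsCycle C renaming (step to v-step)

  -- Vertex lists of a given length are searched through their codes; decoding recovers a list only
  -- pointwise, hence `isCycle-cong`.
  hasCycle? : Unary.Decidable (HasCycle G)
  hasCycle? zero    = no λ ()
  hasCycle? (suc m) = map′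
    (λ (x , C) → cycle (finToFun x) C)
    (λ { (cycle v C) → funToFin v , isCycle-cong (sym ∘ finToFun-funToFin v) C })
    (any? {n = order ^ suc m} λ x → isCycle? (finToFun x))

least : ∀ {P : ℕ → Set} → Unary.Decidable P → ∀ n → P n → ∃[ m ] P m × (∀ ℓ → P ℓ → m ≤ ℓ)
least {P} P? = <-rec _ descend
  where
  descend : ∀ n → (∀ {m} → m < n → P m → ∃[ m ] P m × (∀ ℓ → P ℓ → m ≤ ℓ)) →
            P n → ∃[ m ] P m × (∀ ℓ → P ℓ → m ≤ ℓ)
  descend n rec pn with ℕ.anyUpTo? P? n
  ... | yes (m , m<n , pm) = rec m<n pm
  ... | no ¬smaller        = n , pn , λ ℓ pℓ → ℕ.≮⇒≥ λ ℓ<n → ¬smaller (ℓ , ℓ<n , pℓ)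

girthAtLeast : ∀ {d g} (C : Cover (3 + d)) → ClosedWalkBound C g → GirthAtLeast g (graph C)
girthAtLeast C bound with m , hasCycle ← has-cycle C
                     with γ , minimal@(γ-cycle , _) ← least (hasCycle? (graph C)) m hasCycle =
  γ , minimal , cycle-bound C bound γ-cycle

proposition5 : (Δ g : ℕ) → 3 ≤ Δ → 3 ≤ g →
    Σ[ G ∈ Graph ] (Regular Δ G × GirthAtLeast g G ×
    (Σ[ α ∈ Colouring G (suc Δ) ] (Proper G α × Frozen G α)))
-- The pattern exhibits `suc Δ` as `3 + d`, the number of colours that `girthAtLeast` asks for.
proposition5 Δ@(suc (suc _)) g _ _ =
  graph C , regular C , girthAtLeast C (tower-bound Δ g) , Cover.col C ,
  (λ {x} {y} → Cover.col-proper C {x} {y}) , Cover.col-frozen C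
  where
  C : Cover (suc Δ)
  C = tower Δ g
proposition5 (suc zero) _ (s≤s ()) _
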